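{- Fix an integer $r\geq 3$, and let $d_{r,1}=3^r-1$ and $c_{r,1}=(4^r-1)-d_{r,1}=4^r-3^r$. Then: (i) The order of $f_{r,1}(x):=1+x+x^{2^r-1}+x^{2^r+1}\in\mathbb{F}_2[x]$ divides $4^r-1$. (ii) The polynomial $h_{r,1}(x):=(1+x^{4^r-1})/f_{r,1}(x)\in\mathbb{F}_2[x]$ satisfies $\ell_1(h_{r,1}(x))=c_{r,1}$. (iii) Hence $\beta_{4^r-1}(f_{r,1})=(c_{r,1},d_{r,1})$, and $f_{r,1}(x)$ is robust.
   Context: For $f\in\mathbb{F}_2[x]$ with $f(0)=1$ and $\deg f\ge 1$, the order $\operatorname{ord}(f)$ is the least integer $D\ge 1$ such that $f(x)\mid 1+x^D$ in $\mathbb{F}_2[x]$. For $g\in\mathbb{F}_2[x]$, $\ell_1(g)$ is the number of monomials of $g$ (terms with coefficient $1$), and for $N\ge\deg g$, $\ell_{0,N}(g)$ is the number of exponents $k\in\{0,1,\dots,N\}$ for which the coefficient of $x^k$ in $g$ is $0$. If $N$ is a positive multiple of $\operatorname{ord}(f)$ and $g(x)=(1+x^N)/f(x)$, then $\beta_N(f)=(\ell_1(g),\ell_{0,N-1}(g))$. With $D=\operatorname{ord}(f)$ and $f^*(x)=(1+x^D)/f(x)$, the polynomial $f$ is called robust if $\ell_1(f^*)>\ell_{0,D-1}(f^*)+1$, equivalently $\ell_1(f^*)>(D+1)/2$. -}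

module Defs where

open import Algebra.Bundles.Raw using (RawMagma)
import Algebra.Definitions.RawMagma as RawMagmaDefs
open import Data.Bool.Base using (Bool; true; false; _∧_; _xor_)
open import Data.Bool.Properties using (_≟_)
open import Data.List.Base
  using (List; []; _∷_; [_]; _++_; map; replicate; filter; length; upTo)
open import Data.Nat.Base as ℕ using (ℕ; zero; suc; _∸_; _^_; _≤_; _<_; _>_)
open import Data.Nat.Divisibility using () renaming (_∣_ to _∣ℕ_)
open import Data.Nat.Properties using (∸-+-assoc; m+[n∸m]≡n; m^n>0)
open import Data.Product.Base using (_×_; _,_; ∃-syntax)
open import Level using (0ℓ)
open import Relation.Binary.PropositionalEquality.Core using (_≡_; trans; cong)

infix  4 _≈_
infixl 6 _+_
infixl 7 _*_
infix  8 x^_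
infix  6 1+x^_

-- F₂ is Bool with _xor_ as addition and _∧_ as multiplication.  A polynomial
-- is its list of coefficients, constant term first; trailing zeros are allowed,
-- so equality of polynomials is _≈_ rather than _≡_.

Poly : Set
Poly = List Bool

coeff : Poly → ℕ → Bool
coeff []      _       = false
coeff (a ∷ p) zero    = a
coeff (a ∷ p) (suc k) = coeff p k

_≈_ : Poly → Poly → Set
p ≈ q = ∀ k → coeff p k ≡ coeff q k

_+_ : Poly → Poly → Poly
[]      + q       = q
(a ∷ p) + []      = a ∷ p
(a ∷ p) + (b ∷ q) = (a xor b) ∷ (p + q)

_*_ : Poly → Poly → Poly
[]      * q = []
(a ∷ p) * q = map (a ∧_) q + (false ∷ p * q)

x^_ : ℕ → Poly
x^ n = replicate n false ++ [ true ]

1+x^_ : ℕ → Poly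
1+x^ n = x^ 0 + x^ n

*-rawMagma : RawMagma 0ℓ 0ℓ
*-rawMagma = record { Carrier = Poly ; _≈_ = _≈_ ; _∙_ = _*_ }

open RawMagmaDefs *-rawMagma public using (_∣_)

-- D = ord(f); the order is only defined when f(0) = 1 and deg f ≥ 1.
record IsOrder (f : Poly) (D : ℕ) : Set where
  field
    constantTerm : coeff f 0 ≡ true
    degree≥1     : ∃[ k ] 1 ≤ k × coeff f k ≡ true
    positive     : 1 ≤ D
    divides      : f ∣ 1+x^ D
    least        : ∀ E → 1 ≤ E → f ∣ 1+x^ E → D ≤ E

-- g = (1 + x^N) / f.  For f ≠ 0 such a g is unique up to _≈_, because F₂[x] is
-- an integral domain.
IsQuotient : (N : ℕ) (f g : Poly) → Set
IsQuotient N f g = f * g ≈ 1+x^ N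

ℓ₁ : Poly → ℕ
ℓ₁ g = length (filter (_≟ true) g)

-- Intended for N ≥ deg g; upTo (suc N) lists 0, …, N.
ℓ₀ : ℕ → Poly → ℕ
ℓ₀ N g = length (filter (λ k → coeff g k ≟ false) (upTo (suc N)))

-- β_N(f) = (a , b), with N required to be a positive multiple of ord(f).
IsBeta : (N : ℕ) (f : Poly) → ℕ × ℕ → Set
IsBeta N f ab =
  1 ≤ N ×
  (∃[ D ] IsOrder f D × D ∣ℕ N) ×
  (∃[ g ] IsQuotient N f g × (ℓ₁ g , ℓ₀ (N ∸ 1) g) ≡ ab)

Robust : Poly → Set
Robust f =
  ∃[ D ] ∃[ f* ] IsOrder f D × IsQuotient D f f* ×
    ℓ₁ f* > ℓ₀ (D ∸ 1) f* ℕ.+ 1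

f₁ : ℕ → Poly
f₁ r = x^ 0 + x^ 1 + x^ (2 ^ r ∸ 1) + x^ (2 ^ r ℕ.+ 1)

d₁ : ℕ → ℕ
d₁ r = 3 ^ r ∸ 1

c₁ : ℕ → ℕ
c₁ r = (4 ^ r ∸ 1) ∸ d₁ r

c₁≡4^r∸3^r : ∀ r → c₁ r ≡ 4 ^ r ∸ 3 ^ r
c₁≡4^r∸3^r r = trans (∸-+-assoc (4 ^ r) 1 (d₁ r))
                     (cong (4 ^ r ∸_) (m+[n∸m]≡n (m^n>0 3 r)))

{-# OPTIONS --safe #-}

-- Put q = 2^r, N = q² - 1 and u = x + x^q + x^(q+1), so that x f = (1 + x) u.
-- Then P = u^(q-1) is the product of the u^2ⁱ = x^2ⁱ + x^(q 2ⁱ) + x^((q+1) 2ⁱ)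
-- over i < r: for a, b < q the monomial x^(a + q b) occurs in P exactly when
-- every one of the r bits is set in a or in b, so P has 3^r monomials (a
-- Sierpiński triangle).  Since u P = u^q = x^q + x^(q²) + x^(q² + q), the
-- polynomial h = (1 + x + … + x^N) + P satisfies f h = 1 + x^N; its monomials
-- are the 4^r - 3^r exponents up to N that are missing from P.
--
-- The order is N itself.  If f divides 1 + x^E with 1 ≤ E < N, the coefficients
-- of h are E-periodic modulo N.  In the q × q table of the coefficients, row 0
-- is 1 … 1 0, every row ends in 0, and every later row has another 0; writing
-- E = a + q b, the shift by E moves a 0 onto a 1.
module Submission where

open import Defs
open import Algebra.Bundles using (AbelianGroup; CommutativeRing)
open import Algebra.Definitions.RawMagma using () renaming (_,_ to _∣-by_)
import Algebra.Properties.CommutativeSemigroup as CommutativeSemigroupProperties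
import Algebra.Solver.Ring as RingSolver
open import Algebra.Solver.Ring.AlmostCommutativeRing
  using (AlmostCommutativeRing; fromCommutativeRing; _-Raw-AlmostCommutative⟶_)
open import Data.Bool.Base using (Bool; true; false; not; _∧_; _xor_)
open import Data.Bool.Properties as Bool
  using (xor-assoc; xor-comm; xor-identityʳ; xor-same; xor-∧-commutativeRing)
open import Data.Empty using (⊥; ⊥-elim)
open import Data.List.Base
  using (List; []; _∷_; [_]; _++_; map; replicate; filter; length; concat; applyUpTo)
open import Data.List.Properties using (length-replicate; length-++; length-map; filter-++; concat-++; ++-assoc)
open import Data.List.Relation.Unary.All as All using (All; []; _∷_)
open import Data.List.Relation.Unary.All.Properties using (++⁺; map⁺)
open import Data.Maybe.Base using (Maybe; just; nothing)
open import Data.Nat.Base as ℕ using (ℕ; zero; suc; _∸_; _^_; _≤_; _<_; _>_; s≤s; z≤n)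
open import Data.Nat.Divisibility using (∣-refl) renaming (_∣_ to _∣ℕ_)
open import Data.Nat.DivMod using (_/_; _%_; m%n<n; m≡m%n+[m/n]*n)
import Data.Nat.Properties as ℕ
open import Data.Product.Base using (_×_; _,_; ∃-syntax; proj₁; proj₂)
open import Data.Sum.Base using (inj₁; inj₂)
open import Level using (0ℓ)
open import Relation.Binary.Definitions using (tri<; tri≈; tri>)
open import Relation.Binary.PropositionalEquality
  using (_≡_; refl; sym; trans; cong; cong₂; subst)
import Relation.Binary.Reasoning.Setoid as SetoidReasoning
open import Relation.Nullary.Decidable using (yes; no)

-- _≈_ unfolds to a Π-type from which Agda cannot recover the polynomials;
-- the record makes them inferable.
infix 4 _≋_
record _≋_ (p q : Poly) : Set where
  constructor pointwise
  field at : p ≈ q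
open _≋_

≋-refl : ∀ {p} → p ≋ p
≋-refl = pointwise λ _ → refl

≋-reflexive : ∀ {p q} → p ≡ q → p ≋ q
≋-reflexive refl = ≋-refl

≋-sym : ∀ {p q} → p ≋ q → q ≋ p
≋-sym e = pointwise λ k → sym (at e k)

≋-trans : ∀ {p q s} → p ≋ q → q ≋ s → p ≋ s
≋-trans e e′ = pointwise λ k → trans (at e k) (at e′ k)

coeff-+ : ∀ p q k → coeff (p + q) k ≡ coeff p k xor coeff q k
coeff-+ []      q       k       = refl
coeff-+ (a ∷ p) []      k       = sym (xor-identityʳ _)
coeff-+ (a ∷ p) (b ∷ q) zero    = refl
coeff-+ (a ∷ p) (b ∷ q) (suc k) = coeff-+ p q k

+-cong : ∀ {p p′ q q′} → p ≋ p′ → q ≋ q′ → p + q ≋ p′ + q′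
+-cong {p} {p′} {q} {q′} e e′ = pointwise λ k →
  trans (coeff-+ p q k)
    (trans (cong₂ _xor_ (at e k) (at e′ k)) (sym (coeff-+ p′ q′ k)))

+-assoc : ∀ p q s → (p + q) + s ≋ p + (q + s)
+-assoc p q s = pointwise λ k →
  trans (trans (coeff-+ (p + q) s k) (cong (_xor coeff s k) (coeff-+ p q k)))
    (trans (xor-assoc (coeff p k) (coeff q k) (coeff s k))
      (sym (trans (coeff-+ p (q + s) k) (cong (coeff p k xor_) (coeff-+ q s k)))))

+-comm : ∀ p q → p + q ≋ q + p
+-comm p q = pointwise λ k →
  trans (coeff-+ p q k)
    (trans (xor-comm (coeff p k) (coeff q k)) (sym (coeff-+ q p k)))

+-identityʳ : ∀ p → p + [] ≋ p
+-identityʳ p = pointwise λ k → trans (coeff-+ p [] k) (xor-identityʳ _)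

+-self : ∀ p → p + p ≋ []
+-self p = pointwise λ k → trans (coeff-+ p p k) (xor-same (coeff p k))

+-abelianGroup : AbelianGroup 0ℓ 0ℓ
+-abelianGroup = record
  { _≈_ = _≋_ ; _∙_ = _+_ ; ε = [] ; _⁻¹ = λ p → p
  ; isAbelianGroup = record
    { isGroup = record
      { isMonoid = record
        { isSemigroup = record
          { isMagma = record
            { isEquivalence = record { refl = ≋-refl ; sym = ≋-sym ; trans = ≋-trans }
            ; ∙-cong = +-cong }
          ; assoc = +-assoc }
        ; identity = (λ _ → ≋-refl) , +-identityʳ }
      ; inverse = +-self , +-self
      ; ⁻¹-cong = λ e → e }
    ; comm = +-comm } }

open AbelianGroup +-abelianGroup using (setoid)
  renaming (commutativeSemigroup to +-commutativeSemigroup)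
open CommutativeSemigroupProperties +-commutativeSemigroup
  using (interchange; x∙yz≈y∙xz)
open SetoidReasoning setoid
open CommutativeSemigroupProperties ℕ.+-commutativeSemigroup
  using () renaming (interchange to ℕ-interchange; x∙yz≈y∙xz to ℕ-x∙yz≈y∙xz)

∷-cong : ∀ {a b p q} → a ≡ b → p ≋ q → a ∷ p ≋ b ∷ q
∷-cong a≡b e = pointwise λ { zero → a≡b ; (suc k) → at e k }

false∷[] : false ∷ [] ≋ []
false∷[] = pointwise λ { zero → refl ; (suc k) → refl }

∷-tail : ∀ {a b p q} → a ∷ p ≋ b ∷ q → p ≋ q
∷-tail e = pointwise λ k → at e (suc k)

scale : Bool → Poly → Poly
scale a = map (a ∧_)

coeff-scale : ∀ a p k → coeff (scale a p) k ≡ a ∧ coeff p k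
coeff-scale a []      k       = sym (Bool.∧-zeroʳ a)
coeff-scale a (b ∷ p) zero    = refl
coeff-scale a (b ∷ p) (suc k) = coeff-scale a p k

scale-cong : ∀ a {p q} → p ≋ q → scale a p ≋ scale a q
scale-cong a {p} {q} e = pointwise λ k →
  trans (coeff-scale a p k)
    (trans (cong (a ∧_) (at e k)) (sym (coeff-scale a q k)))

scale-false : ∀ p → scale false p ≋ []
scale-false p = pointwise (coeff-scale false p)

scale-true : ∀ p → scale true p ≋ p
scale-true p = pointwise (coeff-scale true p)

scale-distribʳ-xor : ∀ a b p → scale (a xor b) p ≋ scale a p + scale b p
scale-distribʳ-xor a b p = pointwise λ k →
  trans (coeff-scale (a xor b) p k)
    (trans (Bool.∧-distribʳ-xor (coeff p k) a b)
      (sym (trans (coeff-+ (scale a p) (scale b p) k)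
        (cong₂ _xor_ (coeff-scale a p k) (coeff-scale b p k)))))

false∷-* : ∀ p q → (false ∷ p) * q ≋ false ∷ (p * q)
false∷-* p q = +-cong (scale-false q) ≋-refl

*-zeroʳ : ∀ p → p * [] ≋ []
*-zeroʳ []      = ≋-refl
*-zeroʳ (a ∷ p) = ≋-trans (∷-cong refl (*-zeroʳ p)) false∷[]

*-congˡ : ∀ p {q q′} → q ≋ q′ → p * q ≋ p * q′
*-congˡ []      e = ≋-refl
*-congˡ (a ∷ p) e = +-cong (scale-cong a e) (∷-cong refl (*-congˡ p e))

-- `_*_` recurses on its left factor; this is the matching recursion on the right factor, from which
-- commutativity follows by induction.
*-∷ : ∀ q a p → q * (a ∷ p) ≋ scale a q + (false ∷ q * p)
*-∷ []      a p = ≋-sym false∷[]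
*-∷ (b ∷ q) a p = ∷-cong (cong (_xor false) (Bool.∧-comm b a)) (begin
  scale b p + q * (a ∷ p)                 ≈⟨ +-cong ≋-refl (*-∷ q a p) ⟩
  scale b p + (scale a q + (false ∷ q * p)) ≈⟨ x∙yz≈y∙xz (scale b p) (scale a q) _ ⟩
  scale a q + (scale b p + (false ∷ q * p)) ∎)

*-comm : ∀ p q → p * q ≋ q * p
*-comm []      q = ≋-sym (*-zeroʳ q)
*-comm (a ∷ p) q =
  ≋-trans (+-cong ≋-refl (∷-cong refl (*-comm p q))) (≋-sym (*-∷ q a p))

-- Equal polynomials may be lists of different lengths, so the recursion does not run through `p`
-- and `p′` in parallel; commutativity moves them to the right factor.
*-congʳ : ∀ q {p p′} → p ≋ p′ → p * q ≋ p′ * q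
*-congʳ q {p} {p′} e =
  ≋-trans (*-comm p q) (≋-trans (*-congˡ q e) (*-comm q p′))

*-distribʳ-+ : ∀ s p q → (p + q) * s ≋ p * s + q * s
*-distribʳ-+ s []      q       = ≋-refl
*-distribʳ-+ s (a ∷ p) []      = ≋-sym (+-identityʳ _)
*-distribʳ-+ s (a ∷ p) (b ∷ q) = begin
  scale (a xor b) s + (false ∷ (p + q) * s)
    ≈⟨ +-cong (scale-distribʳ-xor a b s) (∷-cong refl (*-distribʳ-+ s p q)) ⟩
  (scale a s + scale b s) + ((false ∷ p * s) + (false ∷ q * s))
    ≈⟨ interchange (scale a s) (scale b s) _ _ ⟩
  (a ∷ p) * s + (b ∷ q) * s ∎

*-distribˡ-+ : ∀ s p q → s * (p + q) ≋ s * p + s * q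
*-distribˡ-+ s p q = begin
  s * (p + q)   ≈⟨ *-comm s (p + q) ⟩
  (p + q) * s   ≈⟨ *-distribʳ-+ s p q ⟩
  p * s + q * s ≈⟨ +-cong (*-comm p s) (*-comm q s) ⟩
  s * p + s * q ∎

scale-* : ∀ a p q → scale a p * q ≋ scale a (p * q)
scale-* false p q = ≋-trans (*-congʳ q (scale-false p)) (≋-sym (scale-false (p * q)))
scale-* true  p q = ≋-trans (*-congʳ q (scale-true p)) (≋-sym (scale-true (p * q)))

*-assoc : ∀ p q s → (p * q) * s ≋ p * (q * s)
*-assoc []      q s = ≋-refl
*-assoc (a ∷ p) q s = begin
  (scale a q + (false ∷ p * q)) * s
    ≈⟨ *-distribʳ-+ s (scale a q) _ ⟩
  scale a q * s + (false ∷ p * q) * s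
    ≈⟨ +-cong (scale-* a q s) (≋-trans (false∷-* (p * q) s) (∷-cong refl (*-assoc p q s))) ⟩
  (a ∷ p) * (q * s) ∎

*-identityˡ : ∀ p → [ true ] * p ≋ p
*-identityˡ p = begin
  scale true p + (false ∷ []) ≈⟨ +-cong (scale-true p) false∷[] ⟩
  p + []                      ≈⟨ +-identityʳ p ⟩
  p                           ∎

commutativeRing : CommutativeRing 0ℓ 0ℓ
commutativeRing = record
  { _≈_ = _≋_ ; _+_ = _+_ ; _*_ = _*_ ; -_ = λ p → p ; 0# = [] ; 1# = [ true ]
  ; isCommutativeRing = record
    { isRing = record
      { +-isAbelianGroup = AbelianGroup.isAbelianGroup +-abelianGroup
      ; *-cong = λ {p} {p′} {q} {q′} e e′ → ≋-trans (*-congʳ q e) (*-congˡ p′ e′)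
      ; *-assoc = *-assoc
      ; *-identity = *-identityˡ , λ p → ≋-trans (*-comm p [ true ]) (*-identityˡ p)
      ; distrib = *-distribˡ-+ , *-distribʳ-+ }
    ; *-comm = *-comm } }

open CommutativeRing commutativeRing using (*-cong; *-identityʳ)

polyRing : AlmostCommutativeRing 0ℓ 0ℓ
polyRing = fromCommutativeRing commutativeRing

constants : CommutativeRing.rawRing xor-∧-commutativeRing -Raw-AlmostCommutative⟶ polyRing
constants = record
  { ⟦_⟧    = [_]
  ; +-homo = λ _ _ → ≋-refl
  ; *-homo = λ a b → ∷-cong (sym (xor-identityʳ (a ∧ b))) ≋-refl
  ; -‿homo = λ _ → ≋-refl
  ; 0-homo = false∷[]
  ; 1-homo = ≋-refl }

constant≟ : (a b : Bool) → Maybe ([ a ] ≋ [ b ])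
constant≟ a b with a Bool.≟ b
... | yes refl = just ≋-refl
... | no _     = nothing

-- With coefficients in F₂ rather than ℤ, normalisation also uses p + p ≈ 0.
open RingSolver (CommutativeRing.rawRing xor-∧-commutativeRing) polyRing constants constant≟
  using (solve; _:=_; _:+_; _:*_; con)

-- Powers of x, concatenation and geometric sums.

x^*-shift : ∀ n p → x^ n * p ≋ replicate n false ++ p
x^*-shift zero    p = *-identityˡ p
x^*-shift (suc n) p = ≋-trans (false∷-* (x^ n) p) (∷-cong refl (x^*-shift n p))

x^-+ : ∀ m n → x^ m * x^ n ≋ x^ (m ℕ.+ n)
x^-+ zero    n = *-identityˡ (x^ n)
x^-+ (suc m) n = ≋-trans (false∷-* (x^ m) (x^ n)) (∷-cong refl (x^-+ m n))

-- Turns the gluing of lists into a shift and a sum, so that ring identities apply to tables stored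
-- row after row.
++≋+ : ∀ p q → p ++ q ≋ p + x^ length p * q
++≋+ []      q = ≋-sym (*-identityˡ q)
++≋+ (a ∷ p) q = begin
  a ∷ (p ++ q)                      ≈⟨ ∷-cong (sym (xor-identityʳ a)) (++≋+ p q) ⟩
  (a ∷ p) + (false ∷ x^ length p * q) ≈⟨ +-cong (≋-refl {a ∷ p}) (false∷-* (x^ length p) q) ⟨
  (a ∷ p) + x^ suc (length p) * q   ∎

coeff-++ˡ : ∀ p q {k} → k < length p → coeff (p ++ q) k ≡ coeff p k
coeff-++ˡ (a ∷ p) q {zero}  _         = refl
coeff-++ˡ (a ∷ p) q {suc k} (s≤s k<l) = coeff-++ˡ p q k<l

coeff-++ʳ : ∀ p q k → coeff (p ++ q) (length p ℕ.+ k) ≡ coeff q k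
coeff-++ʳ []      q k = refl
coeff-++ʳ (a ∷ p) q k = coeff-++ʳ p q k

coeff-++ʳ′ : ∀ {n} p q k → length p ≡ n → coeff (p ++ q) (n ℕ.+ k) ≡ coeff q k
coeff-++ʳ′ p q k refl = coeff-++ʳ p q k

coeff-replicate : ∀ n k → coeff (replicate n false) k ≡ false
coeff-replicate zero    k       = refl
coeff-replicate (suc n) zero    = refl
coeff-replicate (suc n) (suc k) = coeff-replicate n k

coeff-≥length : ∀ p {k} → length p ≤ k → coeff p k ≡ false
coeff-≥length []      _         = refl
coeff-≥length (a ∷ p) (s≤s l≤k) = coeff-≥length p l≤k

coeff-x^*-≥ : ∀ n p k → coeff (x^ n * p) (n ℕ.+ k) ≡ coeff p k
coeff-x^*-≥ n p k = trans (at (x^*-shift n p) (n ℕ.+ k))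
  (coeff-++ʳ′ (replicate n false) p k (length-replicate n))

coeff-x^*-< : ∀ n p {k} → k < n → coeff (x^ n * p) k ≡ false
coeff-x^*-< n p {k} k<n = trans (at (x^*-shift n p) k)
  (trans (coeff-++ˡ (replicate n false) p (subst (k <_) (sym (length-replicate n)) k<n))
    (coeff-replicate n k))

ones : ℕ → Poly
ones n = replicate n true

geometric : ∀ n → (x^ 0 + x^ 1) * ones n ≋ 1+x^ n
geometric zero    = ≋-trans (*-zeroʳ (x^ 0 + x^ 1)) (≋-sym (+-self (x^ 0)))
geometric (suc n) = begin
  (x^ 0 + x^ 1) * (true ∷ ones n)
    ≈⟨ *-congˡ (x^ 0 + x^ 1) (++≋+ [ true ] (ones n)) ⟩
  (x^ 0 + x^ 1) * (x^ 0 + x^ 1 * ones n)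
    ≈⟨ solve 2 (λ x s → (con true :+ x) :* (con true :+ x :* s)
                 := (con true :+ x) :+ x :* ((con true :+ x) :* s)) ≋-refl (x^ 1) (ones n) ⟩
  (x^ 0 + x^ 1) + x^ 1 * ((x^ 0 + x^ 1) * ones n)
    ≈⟨ +-cong (≋-refl {x^ 0 + x^ 1}) (*-congˡ (x^ 1) (geometric n)) ⟩
  (x^ 0 + x^ 1) + x^ 1 * (x^ 0 + x^ n)
    ≈⟨ solve 2 (λ x y → (con true :+ x) :+ x :* (con true :+ y)
                 := con true :+ x :* y) ≋-refl (x^ 1) (x^ n) ⟩
  x^ 0 + x^ 1 * x^ n
    ≈⟨ +-cong (≋-refl {x^ 0}) (x^-+ 1 n) ⟩
  x^ 0 + x^ suc n ∎

-- Negation in F₂ adds 1. This links h as the set of exponents missing from P, used for counting, to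
-- h as a sum, used for f h = 1 + x^N.
map-not : ∀ p → map not p ≡ ones (length p) + p
map-not []      = refl
map-not (a ∷ p) = cong (not a ∷_) (map-not p)

-- Coefficient tables in Horner form.

horner : ℕ → List Poly → Poly
horner q []      = []
horner q (R ∷ M) = R + x^ q * horner q M

-- `horner q` sums x^(q b) R_b over the rows R_b, whatever their lengths; it is the concatenation
-- when each row fills exactly `q` places. The inductions below can thus keep `q` fixed while the
-- rows grow.
concat≋horner : ∀ {q M} → All (λ R → length R ≡ q) M → concat M ≋ horner q M
concat≋horner []                     = ≋-refl
concat≋horner {M = R ∷ M} (refl ∷ e) = ≋-trans (++≋+ R (concat M))
  (+-cong (≋-refl {R}) (*-congˡ (x^ length R) (concat≋horner e)))

horner-++ : ∀ q M M′ → horner q (M ++ M′) ≋ horner q M + x^ (length M ℕ.* q) * horner q M′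
horner-++ q []      M′ = ≋-sym (*-identityˡ _)
horner-++ q (R ∷ M) M′ = begin
  R + x^ q * horner q (M ++ M′)
    ≈⟨ +-cong (≋-refl {R}) (*-congˡ (x^ q) (horner-++ q M M′)) ⟩
  R + x^ q * (horner q M + x^ (length M ℕ.* q) * horner q M′)
    ≈⟨ solve 5 (λ R y H z H′ → R :+ y :* (H :+ z :* H′) := (R :+ y :* H) :+ (y :* z) :* H′)
         ≋-refl R (x^ q) (horner q M) (x^ (length M ℕ.* q)) (horner q M′) ⟩
  (R + x^ q * horner q M) + (x^ q * x^ (length M ℕ.* q)) * horner q M′
    ≈⟨ +-cong (≋-refl {horner q (R ∷ M)}) (*-congʳ (horner q M′) (x^-+ q (length M ℕ.* q))) ⟩
  horner q (R ∷ M) + x^ (q ℕ.+ length M ℕ.* q) * horner q M′ ∎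

horner-map : ∀ q f c {M} → All (λ R → f R ≋ c * R) M → horner q (map f M) ≋ c * horner q M
horner-map q f c []                = ≋-sym (*-zeroʳ c)
horner-map q f c {R ∷ M} (fR ∷ fM) = begin
  f R + x^ q * horner q (map f M)   ≈⟨ +-cong fR (*-congˡ (x^ q) (horner-map q f c fM)) ⟩
  c * R + x^ q * (c * horner q M)
    ≈⟨ solve 4 (λ c R y H → c :* R :+ y :* (c :* H) := c :* (R :+ y :* H))
         ≋-refl c R (x^ q) (horner q M) ⟩
  c * (R + x^ q * horner q M) ∎

-- The Sierpiński table.

top : ℕ → ℕ
top zero    = 0
top (suc s) = top s ℕ.+ suc (top s)

-- Writing 2^s as `suc (top s)` exposes the successor, and `suc (top (suc s))` reduces to
-- `suc (top s)` added to itself.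
suc-top : ∀ s → suc (top s) ≡ 2 ^ s
suc-top zero    = refl
suc-top (suc s) = cong₂ ℕ._+_ (suc-top s) (trans (suc-top s) (sym (ℕ.+-identityʳ (2 ^ s))))

pad : ℕ → Poly → Poly
pad s R = replicate (suc (top s)) false ++ R

double : Poly → Poly
double R = R ++ R

-- Column a of row b is 1 exactly when each of the s bits is set in a or in b;
-- pad and double extend a row according to the top bit of b.
rows : ℕ → List Poly
rows zero    = [ [ true ] ]
rows (suc s) = map (pad s) (rows s) ++ map double (rows s)

length-rows : ∀ s → length (rows s) ≡ suc (top s)
length-rows zero    = refl
length-rows (suc s) = trans (length-++ (map (pad s) (rows s)))
  (cong₂ ℕ._+_ (trans (length-map (pad s) (rows s)) (length-rows s))
               (trans (length-map double (rows s)) (length-rows s)))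

-- The index `m` = 2^s - 1 of the last column has all its bits set, so the entry there is 1 in every
-- row.
record Row (m : ℕ) (R : Poly) : Set where
  constructor row
  field
    size : length R ≡ suc m
    last : coeff R m ≡ true
open Row

pad-row : ∀ s {R} → Row (top s) R → Row (top (suc s)) (pad s R)
pad-row s {R} (row l c) = row
  (trans (length-++ (replicate (suc (top s)) false))
    (cong₂ ℕ._+_ (length-replicate (suc (top s))) l))
  (trans (cong (coeff (pad s R)) (ℕ.+-suc (top s) (top s)))
    (trans (coeff-++ʳ′ (replicate (suc (top s)) false) R (top s) (length-replicate (suc (top s)))) c))

double-row : ∀ s {R} → Row (top s) R → Row (top (suc s)) (double R)
double-row s {R} (row l c) = row
  (trans (length-++ R) (cong₂ ℕ._+_ l l))
  (trans (cong (coeff (double R)) (ℕ.+-suc (top s) (top s)))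
    (trans (coeff-++ʳ′ R R (top s) l) c))

rows-row : ∀ s → All (Row (top s)) (rows s)
rows-row zero    = row refl refl ∷ []
rows-row (suc s) = ++⁺ (map⁺ (All.map (pad-row s) (rows-row s)))
                       (map⁺ (All.map (double-row s) (rows-row s)))

-- The product of the trinomials.

trinomial : ℕ → ℕ → Poly
trinomial m n = x^ m + x^ n + x^ m * x^ n

-- Squaring is additive in characteristic 2: the cross terms cancel.
trinomial² : ∀ m n → trinomial m n * trinomial m n ≋ trinomial (m ℕ.+ m) (n ℕ.+ n)
trinomial² m n = begin
  trinomial m n * trinomial m n
    ≈⟨ solve 2 (λ a b → (a :+ b :+ a :* b) :* (a :+ b :+ a :* b)
                 := (a :* a) :+ (b :* b) :+ (a :* a) :* (b :* b)) ≋-refl (x^ m) (x^ n) ⟩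
  (x^ m * x^ m) + (x^ n * x^ n) + (x^ m * x^ m) * (x^ n * x^ n)
    ≈⟨ +-cong (+-cong (x^-+ m m) (x^-+ n n)) (*-cong (x^-+ m m) (x^-+ n n)) ⟩
  trinomial (m ℕ.+ m) (n ℕ.+ n) ∎

-- Let n = 2^s and y = x^q. Rows whose top bit is clear contribute the factor x^n, those whose top
-- bit is set contribute (1 + x^n) y^n, and the two add up to the trinomial.
horner-rows-suc : ∀ q s → horner q (rows (suc s)) ≋
                          trinomial (suc (top s)) (suc (top s) ℕ.* q) * horner q (rows s)
horner-rows-suc q s = begin
  horner q (map (pad s) M ++ map double M)
    ≈⟨ horner-++ q (map (pad s) M) (map double M) ⟩
  horner q (map (pad s) M) + x^ (length (map (pad s) M) ℕ.* q) * horner q (map double M)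
    ≡⟨ cong (λ l → horner q (map (pad s) M) + x^ (l ℕ.* q) * horner q (map double M))
            (trans (length-map (pad s) M) (length-rows s)) ⟩
  horner q (map (pad s) M) + x^ (n ℕ.* q) * horner q (map double M)
    ≈⟨ +-cong (horner-map q (pad s) (x^ n) (All.map (λ {R} _ → ≋-sym (x^*-shift n R)) (rows-row s)))
              (*-congˡ (x^ (n ℕ.* q))
                (horner-map q double (x^ 0 + x^ n) (All.map (λ {R} e → double≋ R (size e)) (rows-row s)))) ⟩
  x^ n * horner q M + x^ (n ℕ.* q) * ((x^ 0 + x^ n) * horner q M)
    ≈⟨ solve 3 (λ x y H → x :* H :+ y :* ((con true :+ x) :* H) := (x :+ y :+ x :* y) :* H)
         ≋-refl (x^ n) (x^ (n ℕ.* q)) (horner q M) ⟩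
  trinomial n (n ℕ.* q) * horner q M ∎
  where
  M = rows s
  n = suc (top s)
  double≋ : ∀ R → length R ≡ n → double R ≋ (x^ 0 + x^ n) * R
  double≋ R l = begin
    R ++ R                    ≈⟨ ++≋+ R R ⟩
    R + x^ length R * R       ≡⟨ cong (λ l → R + x^ l * R) l ⟩
    R + x^ n * R
      ≈⟨ solve 2 (λ R x → R :+ x :* R := (con true :+ x) :* R) ≋-refl R (x^ n) ⟩
    (x^ 0 + x^ n) * R         ∎

-- Multiplying by x + y + xy telescopes the product of the trinomials
-- x^2ⁱ + y^2ⁱ + x^2ⁱ y^2ⁱ over i < s, each being the square of the previous one.
trinomial*horner-rows : ∀ q s → trinomial 1 q * horner q (rows s) ≋
                                trinomial (suc (top s)) (suc (top s) ℕ.* q)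
trinomial*horner-rows q zero = begin
  trinomial 1 q * ([ true ] + x^ q * [])
    ≈⟨ *-congˡ (trinomial 1 q) (+-cong (≋-refl {[ true ]}) (*-zeroʳ (x^ q))) ⟩
  trinomial 1 q * [ true ]   ≈⟨ *-identityʳ (trinomial 1 q) ⟩
  trinomial 1 q              ≡⟨ cong (trinomial 1) (ℕ.+-identityʳ q) ⟨
  trinomial 1 (q ℕ.+ 0)      ∎
trinomial*horner-rows q (suc s) = begin
  t * horner q (rows (suc s))      ≈⟨ *-congˡ t (horner-rows-suc q s) ⟩
  t * (t′ * H)
    ≈⟨ solve 3 (λ t t′ H → t :* (t′ :* H) := t′ :* (t :* H)) ≋-refl t t′ H ⟩
  t′ * (t * H)                     ≈⟨ *-congˡ t′ (trinomial*horner-rows q s) ⟩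
  t′ * t′                          ≈⟨ trinomial² n (n ℕ.* q) ⟩
  trinomial (n ℕ.+ n) (n ℕ.* q ℕ.+ n ℕ.* q)
    ≡⟨ cong (trinomial (n ℕ.+ n)) (ℕ.*-distribʳ-+ q n n) ⟨
  trinomial (n ℕ.+ n) ((n ℕ.+ n) ℕ.* q) ∎
  where
  n = suc (top s)
  t = trinomial 1 q
  t′ = trinomial n (n ℕ.* q)
  H = horner q (rows s)

-- The quotient of 1 + x^N by f.

quadrinomial : ℕ → Poly
quadrinomial m = x^ 0 + x^ 1 + x^ m + x^ (suc m ℕ.+ 1)

quadrinomial-factor : ∀ m → x^ 1 * quadrinomial m ≋ (x^ 0 + x^ 1) * trinomial 1 (suc m)
quadrinomial-factor m = begin
  x^ 1 * (x^ 0 + x^ 1 + x^ m + x^ (suc m ℕ.+ 1))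
    ≈⟨ *-congˡ (x^ 1) (+-cong (≋-refl {x^ 0 + x^ 1 + x^ m}) (≋-sym (x^-+ (suc m) 1))) ⟩
  x^ 1 * (x^ 0 + x^ 1 + x^ m + x^ suc m * x^ 1)
    ≈⟨ solve 3 (λ x y z → x :* (con true :+ x :+ y :+ z :* x)
                 := x :+ x :* x :+ x :* y :+ z :* x :* x) ≋-refl (x^ 1) (x^ m) (x^ suc m) ⟩
  x^ 1 + x^ 1 * x^ 1 + x^ 1 * x^ m + x^ suc m * x^ 1 * x^ 1
    ≈⟨ +-cong (+-cong (≋-refl {x^ 1 + x^ 1 * x^ 1}) (x^-+ 1 m)) (≋-refl {x^ suc m * x^ 1 * x^ 1}) ⟩
  x^ 1 + x^ 1 * x^ 1 + x^ suc m + x^ suc m * x^ 1 * x^ 1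
    ≈⟨ solve 2 (λ x z → x :+ x :* x :+ z :+ z :* x :* x
                 := (con true :+ x) :* (x :+ z :+ x :* z)) ≋-refl (x^ 1) (x^ suc m) ⟩
  (x^ 0 + x^ 1) * trinomial 1 (suc m) ∎

-- The identity is shown after multiplication by x, where x f = (1 + x) u applies; `∷-tail` then
-- cancels the x. In u (1 + x^(q²)) + (1 + x) u^q only x and x^(q²) survive.
quadrinomial*complement : ∀ m p → length p ≡ suc m ℕ.* suc m →
  trinomial 1 (suc m) * p ≋ trinomial (suc m) (suc m ℕ.* suc m) →
  quadrinomial m * map not p ≋ 1+x^ (suc m ℕ.* suc m ∸ 1)
quadrinomial*complement m p l tp = ∷-tail (begin
  false ∷ f * map not p          ≈⟨ x^*-shift 1 (f * map not p) ⟨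
  x^ 1 * (f * map not p)         ≈⟨ *-assoc (x^ 1) f (map not p) ⟨
  (x^ 1 * f) * map not p
    ≈⟨ *-cong (quadrinomial-factor m) (≋-reflexive (trans (map-not p) (cong (λ l → ones l + p) l))) ⟩
  ((x^ 0 + x^ 1) * t) * (ones Q + p)
    ≈⟨ solve 4 (λ x t S p → ((con true :+ x) :* t) :* (S :+ p)
                 := t :* ((con true :+ x) :* S) :+ (con true :+ x) :* (t :* p))
         ≋-refl (x^ 1) t (ones Q) p ⟩
  t * ((x^ 0 + x^ 1) * ones Q) + (x^ 0 + x^ 1) * (t * p)
    ≈⟨ +-cong (*-congˡ t (geometric Q)) (*-congˡ (x^ 0 + x^ 1) tp) ⟩
  t * (x^ 0 + x^ Q) + (x^ 0 + x^ 1) * trinomial (suc m) Q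
    ≈⟨ solve 3 (λ x y z → (x :+ y :+ x :* y) :* (con true :+ z) :+
                           (con true :+ x) :* (y :+ z :+ y :* z)
                 := x :+ z) ≋-refl (x^ 1) (x^ suc m) (x^ Q) ⟩
  -- `Q` reduces to a successor, so both powers begin with `false` and the factor x splits off by
  -- computation.
  x^ 1 + x^ Q                    ≡⟨⟩
  false ∷ 1+x^ (Q ∸ 1)           ∎)
  where
  f = quadrinomial m
  t = trinomial 1 (suc m)
  Q = suc m ℕ.* suc m

-- Counting monomials.

ℓ₁-++ : ∀ p q → ℓ₁ (p ++ q) ≡ ℓ₁ p ℕ.+ ℓ₁ q
ℓ₁-++ p q = trans (cong length (filter-++ (Bool._≟ true) p q)) (length-++ (filter (Bool._≟ true) p))

ℓ₁-replicate : ∀ n → ℓ₁ (replicate n false) ≡ 0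
ℓ₁-replicate zero    = refl
ℓ₁-replicate (suc n) = ℓ₁-replicate n

ℓ₁-map-not : ∀ p → ℓ₁ (map not p) ℕ.+ ℓ₁ p ≡ length p
ℓ₁-map-not []          = refl
ℓ₁-map-not (true ∷ p)  = trans (ℕ.+-suc (ℓ₁ (map not p)) (ℓ₁ p)) (cong suc (ℓ₁-map-not p))
ℓ₁-map-not (false ∷ p) = cong suc (ℓ₁-map-not p)

ℓ₁-vanishing : ∀ p → (∀ k → coeff p k ≡ false) → ℓ₁ p ≡ 0
ℓ₁-vanishing []          _ = refl
ℓ₁-vanishing (true ∷ p)  z with () ← z 0
ℓ₁-vanishing (false ∷ p) z = ℓ₁-vanishing p (λ k → z (suc k))

-- Generalised for the induction: `c` stays the coefficient function of the whole polynomial, while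
-- `f` absorbs one successor for each coefficient removed from `p`.
zeros+ℓ₁ : ∀ (c : ℕ → Bool) (f : ℕ → ℕ) p n → (∀ k → c (f k) ≡ coeff p k) →
  (∀ k → n ≤ k → coeff p k ≡ false) →
  length (filter (λ k → c k Bool.≟ false) (applyUpTo f n)) ℕ.+ ℓ₁ p ≡ n
zeros+ℓ₁ c f p           zero    e z = ℓ₁-vanishing p (λ k → z k z≤n)
zeros+ℓ₁ c f []          (suc n) e z with c (f 0) | e 0
... | false | refl = cong suc (zeros+ℓ₁ c (λ k → f (suc k)) [] n (λ k → e (suc k)) (λ _ _ → refl))
zeros+ℓ₁ c f (a ∷ p)     (suc n) e z with c (f 0) | e 0
... | false | refl = cong suc (zeros+ℓ₁ c (λ k → f (suc k)) p n (λ k → e (suc k))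
                                        (λ k n≤k → z (suc k) (s≤s n≤k)))
... | true  | refl = trans (ℕ.+-suc _ (ℓ₁ p))
                       (cong suc (zeros+ℓ₁ c (λ k → f (suc k)) p n (λ k → e (suc k))
                                           (λ k n≤k → z (suc k) (s≤s n≤k))))

ℓ₀+ℓ₁ : ∀ p {N} → 1 ≤ N → (∀ k → N ≤ k → coeff p k ≡ false) → ℓ₀ (N ∸ 1) p ℕ.+ ℓ₁ p ≡ N
ℓ₀+ℓ₁ p {suc n} _ z = zeros+ℓ₁ (coeff p) (λ k → k) p (suc n) (λ _ → refl) z

ℓ₁-concat-pad : ∀ s M → ℓ₁ (concat (map (pad s) M)) ≡ ℓ₁ (concat M)
ℓ₁-concat-pad s []      = refl
ℓ₁-concat-pad s (R ∷ M) = trans (ℓ₁-++ (pad s R) _)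
  (trans (cong₂ ℕ._+_
           (trans (ℓ₁-++ (replicate (suc (top s)) false) R)
                  (cong (ℕ._+ ℓ₁ R) (ℓ₁-replicate (suc (top s)))))
           (ℓ₁-concat-pad s M))
    (sym (ℓ₁-++ R (concat M))))

ℓ₁-concat-double : ∀ M → ℓ₁ (concat (map double M)) ≡ ℓ₁ (concat M) ℕ.+ ℓ₁ (concat M)
ℓ₁-concat-double []      = refl
ℓ₁-concat-double (R ∷ M) = trans (ℓ₁-++ (double R) _)
  (trans (cong₂ ℕ._+_ (ℓ₁-++ R R) (ℓ₁-concat-double M))
    (trans (ℕ-interchange (ℓ₁ R) (ℓ₁ R) (ℓ₁ (concat M)) (ℓ₁ (concat M)))
      (sym (cong₂ ℕ._+_ (ℓ₁-++ R (concat M)) (ℓ₁-++ R (concat M))))))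

-- Padding keeps the number of ones and doubling doubles it, so each bit contributes the factor 1 +
-- 2.
ℓ₁-rows : ∀ s → ℓ₁ (concat (rows s)) ≡ 3 ^ s
ℓ₁-rows zero    = refl
ℓ₁-rows (suc s) = trans (cong ℓ₁ (sym (concat-++ (map (pad s) (rows s)) (map double (rows s)))))
  (trans (ℓ₁-++ (concat (map (pad s) (rows s))) (concat (map double (rows s))))
    (trans (cong₂ ℕ._+_ (ℓ₁-concat-pad s (rows s)) (ℓ₁-concat-double (rows s)))
      (trans (cong (λ w → w ℕ.+ (w ℕ.+ w)) (ℓ₁-rows s))
        (cong (λ w → 3 ^ s ℕ.+ (3 ^ s ℕ.+ w)) (sym (ℕ.+-identityʳ (3 ^ s)))))))

length-concat : ∀ {q} {M : List Poly} → All (λ R → length R ≡ q) M →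
                length (concat M) ≡ length M ℕ.* q
length-concat []                 = refl
length-concat {M = R ∷ M} (l ∷ e) = trans (length-++ R) (cong₂ ℕ._+_ l (length-concat e))

length-concat-rows : ∀ s → length (concat (rows s)) ≡ suc (top s) ℕ.* suc (top s)
length-concat-rows s = trans (length-concat (All.map size (rows-row s)))
                             (cong (ℕ._* suc (top s)) (length-rows s))

-- Zeros and ones in the table of h.

coeff-map-not : ∀ p {k} → k < length p → coeff (map not p) k ≡ not (coeff p k)
coeff-map-not (a ∷ p) {zero}  _         = refl
coeff-map-not (a ∷ p) {suc k} (s≤s k<l) = coeff-map-not p k<l

-- One lookup serves two uses: `P` is `Row m` for the last column and `HasInnerOne m` for the rows
-- after the first.
coeff-concat : ∀ {P : Poly → Set} {m M b} → All (Row m) M → All P M → b < length M →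
  ∃[ R ] P R × (∀ {a} → a < suc m → coeff (concat M) (b ℕ.* suc m ℕ.+ a) ≡ coeff R a)
coeff-concat {M = R ∷ M} {zero} (r ∷ _) (pR ∷ _) _ =
  R , pR , λ {a} a<q → coeff-++ˡ R (concat M) (subst (a <_) (sym (size r)) a<q)
coeff-concat {m = m} {M = R ∷ M} {suc b} (r ∷ rs) (_ ∷ ps) (s≤s b<l) =
  let R′ , pR′ , c = coeff-concat rs ps b<l in
  R′ , pR′ , λ {a} a<q →
    trans (cong (coeff (concat (R ∷ M))) (ℕ.+-assoc (suc m) (b ℕ.* suc m) a))
      (trans (coeff-++ʳ′ R (concat M) (b ℕ.* suc m ℕ.+ a) (size r)) (c a<q))

HasInnerOne : ℕ → Poly → Set
HasInnerOne m R = ∃[ a ] a < m × coeff R a ≡ true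

-- In row 0 all bits must come from the column, which leaves only the last one. In a later row,
-- padding shifts an inner 1 to an inner 1, and doubling makes the final 1 of the first copy inner.
rows-inner : ∀ s → ∃[ M ] rows s ≡ x^ top s ∷ M × All (HasInnerOne (top s)) M
rows-inner zero    = [] , refl , []
rows-inner (suc s) with rows s | rows-inner s | rows-row s
... | _ | M , refl , inner | rs =
  map (pad s) M ++ map double (x^ top s ∷ M) ,
  cong (_∷ (map (pad s) M ++ map double (x^ top s ∷ M))) pad-first ,
  ++⁺ (map⁺ (All.map pad-inner inner)) (map⁺ (All.map double-inner rs))
  where
  pad-first : pad s (x^ top s) ≡ x^ top (suc s)
  pad-first = trans (sym (++-assoc (replicate (suc (top s)) false) (replicate (top s) false) [ true ]))
    (cong (_++ [ true ]) (trans (++-replicate (suc (top s)) (top s))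
      (cong (λ n → replicate n false) (sym (ℕ.+-suc (top s) (top s))))))
    where
    ++-replicate : ∀ m n → replicate m false ++ replicate n false ≡ replicate (m ℕ.+ n) false
    ++-replicate zero    n = refl
    ++-replicate (suc m) n = cong (false ∷_) (++-replicate m n)
  pad-inner : ∀ {R} → HasInnerOne (top s) R → HasInnerOne (top (suc s)) (pad s R)
  pad-inner {R} (a , a<m , c) =
    suc (top s) ℕ.+ a ,
    subst (suc (top s) ℕ.+ a <_) (sym (ℕ.+-suc (top s) (top s))) (ℕ.+-monoʳ-< (suc (top s)) a<m) ,
    trans (coeff-++ʳ′ (replicate (suc (top s)) false) R a (length-replicate (suc (top s)))) c
  double-inner : ∀ {R} → Row (top s) R → HasInnerOne (top (suc s)) (double R)
  double-inner {R} (row l c) =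
    top s , ℕ.m<m+n (top s) (s≤s z≤n) ,
    trans (coeff-++ˡ R R (subst (top s <_) (sym l) ℕ.≤-refl)) c

coeff-x^ : ∀ n → coeff (x^ n) n ≡ true
coeff-x^ zero    = refl
coeff-x^ (suc n) = coeff-x^ n

coeff-x^-< : ∀ {n k} → k < n → coeff (x^ n) k ≡ false
coeff-x^-< {suc n} {zero}  _         = refl
coeff-x^-< {suc n} {suc k} (s≤s k<n) = coeff-x^-< k<n

-- What the minimality argument uses of h. With q = `suc m`, row b and column a meet at exponent b q
-- + a, and `m ℕ.+ m ℕ.* suc m` is the reduced form of q² - 1.
record Pattern (m : ℕ) (h : Poly) : Set where
  field
    first-row   : ∀ {a} → a < m → coeff h a ≡ true
    last-column : ∀ {b} → b < suc m → coeff h (b ℕ.* suc m ℕ.+ m) ≡ false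
    later-rows  : ∀ {b} → suc b < suc m → ∃[ a ] a < m × coeff h (suc b ℕ.* suc m ℕ.+ a) ≡ false
    beyond      : ∀ {k} → m ℕ.+ m ℕ.* suc m ≤ k → coeff h k ≡ false

index< : ∀ {q a b} → b < q → a < q → b ℕ.* q ℕ.+ a < q ℕ.* q
index< {q} {a} {b} b<q a<q = ℕ.<-≤-trans (ℕ.+-monoʳ-< (b ℕ.* q) a<q)
  (subst (ℕ._≤ q ℕ.* q) (ℕ.+-comm q (b ℕ.* q)) (ℕ.*-monoˡ-≤ q b<q))

quotient : ℕ → Poly
quotient r = map not (concat (rows r))

quotient-pattern : ∀ s → Pattern (top s) (quotient s)
quotient-pattern s = record
  { first-row = first-row ; last-column = last-column ; later-rows = later-rows ; beyond = beyond }
  where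
  m = top s
  L = concat (rows s)
  complement : ∀ {k} → k < suc m ℕ.* suc m → coeff (quotient s) k ≡ not (coeff L k)
  complement {k} k<Q = coeff-map-not L (subst (k <_) (sym (length-concat-rows s)) k<Q)
  first-row : ∀ {a} → a < m → coeff (quotient s) a ≡ true
  first-row {a} a<m = trans (complement (index< {suc m} {a} {0} (s≤s z≤n) (ℕ.m<n⇒m<1+n a<m))) (cong not zero-entry)
    where
    zero-entry : coeff L a ≡ false
    zero-entry with rows s | rows-inner s | rows-row s
    ... | _ | M , refl , _ | r ∷ _ = trans
      (coeff-++ˡ (x^ m) (concat M) (subst (a <_) (sym (size r)) (ℕ.m<n⇒m<1+n a<m)))
      (coeff-x^-< a<m)
  last-column : ∀ {b} → b < suc m → coeff (quotient s) (b ℕ.* suc m ℕ.+ m) ≡ false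
  last-column {b} b<q =
    let R , r , c = coeff-concat (rows-row s) (rows-row s) (subst (b <_) (sym (length-rows s)) b<q) in
    trans (complement (index< b<q ℕ.≤-refl)) (cong not (trans (c ℕ.≤-refl) (last r)))
  later-rows : ∀ {b} → suc b < suc m →
               ∃[ a ] a < m × coeff (quotient s) (suc b ℕ.* suc m ℕ.+ a) ≡ false
  later-rows {b} b<q =
    let a , a<m , c = one-entry in
    a , a<m , trans (complement (index< b<q (ℕ.m<n⇒m<1+n a<m))) (cong not c)
    where
    one-entry : ∃[ a ] a < m × coeff L (suc b ℕ.* suc m ℕ.+ a) ≡ true
    one-entry with rows s | rows-inner s | rows-row s | length-rows s
    ... | _ | M , refl , inner | r ∷ rs | l =
      let R , (a , a<m , e) , c = coeff-concat rs inner (subst (b <_) (sym (ℕ.suc-injective l)) (ℕ.≤-pred b<q)) in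
      a , a<m ,
      trans (cong (coeff (x^ m ++ concat M)) (ℕ.+-assoc (suc m) (b ℕ.* suc m) a))
        (trans (coeff-++ʳ′ (x^ m) (concat M) _ (size r))
          (trans (c (ℕ.m<n⇒m<1+n a<m)) e))
  beyond : ∀ {k} → m ℕ.+ m ℕ.* suc m ≤ k → coeff (quotient s) k ≡ false
  -- The list has length N + 1, so its length settles only k > N; the coefficient at N itself is the
  -- last entry of the last row.
  beyond {k} N≤k with ℕ.m≤n⇒m<n∨m≡n N≤k
  ... | inj₁ N<k  = coeff-≥length (quotient s)
    (subst (_≤ k) (sym (trans (length-map not L) (length-concat-rows s))) N<k)
  ... | inj₂ refl = subst (λ k → coeff (quotient s) k ≡ false)
    (ℕ.+-comm (m ℕ.* suc m) m) (last-column ℕ.≤-refl)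

-- Here `q` becomes 2^s, the length of the rows, so the concatenated table agrees with its Horner
-- form.
quotient-correct : ∀ s → quadrinomial (top s) * quotient s ≋ 1+x^ (suc (top s) ℕ.* suc (top s) ∸ 1)
quotient-correct s = quadrinomial*complement (top s) (concat (rows s)) (length-concat-rows s)
  (≋-trans (*-congˡ (trinomial 1 (suc (top s))) (concat≋horner (All.map size (rows-row s))))
           (trinomial*horner-rows (suc (top s)) s))

-- Periodicity of the coefficients of h.

coeff-[1+x^]* : ∀ n p k → coeff ((1+x^ n) * p) k ≡ coeff p k xor coeff (x^ n * p) k
coeff-[1+x^]* n p k = trans
  (at (≋-trans (*-distribʳ-+ p (x^ 0) (x^ n)) (+-cong (*-identityˡ p) ≋-refl)) k)
  (coeff-+ p (x^ n * p) k)

xor≡false⇒≡ : ∀ {a b} → a xor b ≡ false → a ≡ b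
xor≡false⇒≡ {false} {false} _ = refl
xor≡false⇒≡ {true}  {true}  _ = refl

-- With E + K = N, multiplying p f = 1 + x^E and f h = 1 + x^N crosswise gives
-- (1 + x^E) h = (1 + x^N) p; hence h, read modulo x^N - 1, is E-periodic.
module Period {f h p : Poly} {E K : ℕ} (1≤E : 1 ≤ E)
  (fh : f * h ≋ 1+x^ (E ℕ.+ K)) (pf : p * f ≋ 1+x^ E)
  (h-beyond : ∀ {k} → E ℕ.+ K ≤ k → coeff h k ≡ false) where

  N = E ℕ.+ K

  crosswise : ∀ k → coeff h k xor coeff (x^ E * h) k ≡ coeff p k xor coeff (x^ N * p) k
  crosswise k = trans (sym (coeff-[1+x^]* E h k)) (trans (at eq k) (coeff-[1+x^]* N p k))
    where
    eq : (1+x^ E) * h ≋ (1+x^ N) * p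
    eq = begin
      (1+x^ E) * h       ≈⟨ *-congʳ h pf ⟨
      (p * f) * h      ≈⟨ *-assoc p f h ⟩
      p * (f * h)      ≈⟨ *-congˡ p fh ⟩
      p * (1+x^ N)       ≈⟨ *-comm p (1+x^ N) ⟩
      (1+x^ N) * p       ∎

  -- At exponent N + E + i both h and x^E h vanish, which leaves only the two terms in p.
  p-recurs : ∀ i → coeff p (N ℕ.+ (E ℕ.+ i)) ≡ coeff p (E ℕ.+ i)
  p-recurs i = xor≡false⇒≡
    (trans (cong (coeff p k xor_) (sym (coeff-x^*-≥ N p (E ℕ.+ i))))
      (trans (sym (crosswise k))
        (cong₂ _xor_ (h-beyond (ℕ.m≤m+n N (E ℕ.+ i)))
          (trans (cong (coeff (x^ E * h)) rearrange)
            (trans (coeff-x^*-≥ E h (N ℕ.+ i)) (h-beyond (ℕ.m≤m+n N i)))))))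
    where
    k = N ℕ.+ (E ℕ.+ i)
    rearrange : k ≡ E ℕ.+ (N ℕ.+ i)
    rearrange = ℕ-x∙yz≈y∙xz N E i

  -- From exponent E on, steps of N preserve the coefficient of p and eventually leave its list.
  p-beyond : ∀ {k} → E ≤ k → coeff p k ≡ false
  p-beyond E≤k = descend (length p) E≤k (ℕ.m≤m+n (length p) _)
    where
    -- `t` is fuel: a step raises `k` by N ≥ 1, so the length bound survives with one unit less.
    descend : ∀ t {k} → E ≤ k → length p ≤ t ℕ.+ k → coeff p k ≡ false
    descend zero        E≤k l = coeff-≥length p l
    descend (suc t) {k} E≤k l with ℕ.m≤n⇒∃[o]m+o≡n E≤k
    ... | i , refl = trans (sym (p-recurs i))
      (descend t (ℕ.≤-trans E≤k (ℕ.m≤n+m k N))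
        (ℕ.≤-trans l (subst (_≤ t ℕ.+ (N ℕ.+ k)) (ℕ.+-suc t k)
          (ℕ.+-monoʳ-≤ t (ℕ.+-monoˡ-≤ k (ℕ.≤-trans 1≤E (ℕ.m≤m+n E K)))))))

  -- At exponent E + j < N, p has already vanished and x^N p has not yet begun.
  periodic : ∀ {j} → E ℕ.+ j < N → coeff h (E ℕ.+ j) ≡ coeff h j
  periodic {j} Ej<N = xor≡false⇒≡
    (trans (cong (coeff h (E ℕ.+ j) xor_) (sym (coeff-x^*-≥ E h j)))
      (trans (crosswise (E ℕ.+ j))
        (cong₂ _xor_ (p-beyond (ℕ.m≤m+n E j)) (coeff-x^*-< N p Ej<N))))

  -- Both sides equal the coefficient of p at j: compare the crosswise identity at N + j, where x^E
  -- h contributes the entry K + j, and at j.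
  periodic-wrap : ∀ {j} → j < E → coeff h (K ℕ.+ j) ≡ coeff h j
  periodic-wrap {j} j<E = trans top-end (sym bottom-end)
    where
    k = N ℕ.+ j
    top-end : coeff h (K ℕ.+ j) ≡ coeff p j
    top-end =
      trans (sym (trans (cong (coeff (x^ E * h)) (ℕ.+-assoc E K j)) (coeff-x^*-≥ E h (K ℕ.+ j))))
        (trans (cong (_xor coeff (x^ E * h) k) (sym (h-beyond (ℕ.m≤m+n N j))))
          (trans (crosswise k)
            (cong₂ _xor_ (p-beyond (ℕ.≤-trans (ℕ.m≤m+n E K) (ℕ.m≤m+n N j)))
                         (coeff-x^*-≥ N p j))))
    bottom-end : coeff h j ≡ coeff p j
    bottom-end =
      trans (sym (xor-identityʳ _))
        (trans (cong (coeff h j xor_) (sym (coeff-x^*-< E h j<E)))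
          (trans (crosswise j)
            (trans (cong (coeff p j xor_) (coeff-x^*-< N p (ℕ.<-≤-trans j<E (ℕ.m≤m+n E K))))
              (xor-identityʳ _))))

-- Minimality of the order.

true≢false : ∀ {A : Set} {a b : Bool} → a ≡ true → b ≡ false → b ≡ a → A
true≢false refl refl ()

order-minimal : ∀ {f h p m E} → 1 ≤ m → Pattern m h →
  f * h ≋ 1+x^ (m ℕ.+ m ℕ.* suc m) → p * f ≋ 1+x^ E → 1 ≤ E → m ℕ.+ m ℕ.* suc m ≤ E
order-minimal {f} {h} {p} {m} {E} 1≤m pattern-h fh pf 1≤E with E ℕ.<? (m ℕ.+ m ℕ.* suc m)
... | no  E≮N = ℕ.≮⇒≥ E≮N
... | yes E<N = ⊥-elim (cases (E % suc m) (E / suc m) (m%n<n E (suc m)) (m≡m%n+[m/n]*n E (suc m)))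
  where
  open Pattern pattern-h
  q N K : ℕ
  q = suc m
  N = m ℕ.+ m ℕ.* q
  K = N ∸ E
  E+K≡N : E ℕ.+ K ≡ N
  E+K≡N = ℕ.m+[n∸m]≡n (ℕ.<⇒≤ E<N)
  open Period {f} {h} {p} {E} {K} 1≤E
    (≋-trans fh (≋-reflexive (cong 1+x^_ (sym E+K≡N)))) pf
    (λ {k} N≤k → beyond (subst (_≤ k) E+K≡N N≤k))
    using (periodic; periodic-wrap)

  inside : ∀ {j} → E ℕ.+ j < N → E ℕ.+ j < E ℕ.+ K
  inside {j} = subst (E ℕ.+ j <_) (sym E+K≡N)

  cases : ∀ a b → a < q → E ≡ a ℕ.+ b ℕ.* q → ⊥
  cases a b a<q E≡ with ℕ.<-cmp b m
  cases a b a<q E≡ | tri> _ _ m<b = ℕ.<⇒≱ E<N (subst (N ≤_) (sym E≡)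
    (ℕ.≤-trans (ℕ.≤-trans (ℕ.n≤1+n N) (ℕ.*-monoˡ-≤ q m<b)) (ℕ.m≤n+m (b ℕ.* q) a)))
  -- E lies in the last row, so the shift wraps around: K = m - a carries the 1 in column `a` of row
  -- 0 to the 0 in column `m`.
  cases a b a<q E≡ | tri≈ _ refl _ =
    true≢false (first-row a<m) (last-column {0} (s≤s z≤n))
      (trans (cong (coeff h) (sym K+a≡m)) (periodic-wrap a<E))
    where
    a<m : a < m
    a<m = ℕ.+-cancelʳ-< (m ℕ.* q) a m (subst (_< N) E≡ E<N)
    a<E : a < E
    a<E = subst (a <_) (sym E≡) (ℕ.m<m+n a (ℕ.*-mono-≤ 1≤m (s≤s {n = m} z≤n)))
    K+a≡m : K ℕ.+ a ≡ m
    K+a≡m = trans (cong (ℕ._+ a) (trans (cong (N ∸_) (trans E≡ (ℕ.+-comm a (m ℕ.* q))))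
                    (trans (sym (ℕ.∸-+-assoc N (m ℕ.* q) a)) (cong (_∸ a) (ℕ.m+n∸n≡m m (m ℕ.* q))))))
                  (ℕ.m∸n+n≡m (ℕ.<⇒≤ a<m))
  cases zero    zero    _ refl | tri< _ _ _ = ℕ.<⇒≱ 1≤E z≤n
  -- The shift lays row 0 over row `suc b` without moving columns; the inner 0 of that row meets a
  -- 1.
  cases zero    (suc b) _ E≡   | tri< b<m _ _ =
    let j , j<m , c = later-rows (ℕ.m<n⇒m<1+n b<m) in
    true≢false (first-row j<m)
      (trans (cong (λ e → coeff h (e ℕ.+ j)) E≡) c)
      (periodic (inside (subst (λ e → e ℕ.+ j < N) (sym E≡)
        (subst (suc b ℕ.* q ℕ.+ j <_) (ℕ.+-comm (m ℕ.* q) m)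
          (ℕ.+-mono-≤-< (ℕ.*-monoˡ-≤ q (ℕ.<⇒≤ b<m)) j<m)))))
  -- The shift carries column m - `suc a` of row 0, a 1, into the last column of row `b`, a 0.
  cases (suc a) b       (s≤s a<m) E≡ | tri< b<m _ _ =
    true≢false (first-row (ℕ.∸-monoʳ-< {m} {suc a} {0} (s≤s z≤n) a<m))
      (trans (cong (coeff h) E+j≡) (last-column (ℕ.m<n⇒m<1+n b<m)))
      (periodic (inside (subst (_< N) (sym E+j≡)
        (subst (b ℕ.* q ℕ.+ m <_) (ℕ.+-comm (m ℕ.* q) m)
          (ℕ.+-monoˡ-< m (ℕ.*-monoˡ-< q b<m))))))
    where
    j = m ∸ suc a
    E+j≡ : E ℕ.+ j ≡ b ℕ.* q ℕ.+ m
    E+j≡ = trans (cong (ℕ._+ j) (trans E≡ (ℕ.+-comm (suc a) (b ℕ.* q))))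
      (trans (ℕ.+-assoc (b ℕ.* q) (suc a) j) (cong (b ℕ.* q ℕ.+_) (ℕ.m+[n∸m]≡n a<m)))

-- Order, counts and robustness in terms of r.

quotient-size : ∀ s → suc (top s) ℕ.* suc (top s) ≡ 4 ^ s
quotient-size s = trans (cong₂ ℕ._*_ (suc-top s) (suc-top s))
  (trans (sym (ℕ.^-distribˡ-+-* 2 s s))
    (trans (cong (λ n → 2 ^ (s ℕ.+ n)) (sym (ℕ.+-identityʳ s))) (sym (ℕ.^-*-assoc 2 2 s))))

f₁≡quadrinomial : ∀ r → f₁ r ≡ quadrinomial (top r)
f₁≡quadrinomial r = cong (λ q → x^ 0 + x^ 1 + x^ (q ∸ 1) + x^ (q ℕ.+ 1)) (sym (suc-top r))

N≡ : ∀ r → 4 ^ r ∸ 1 ≡ top r ℕ.+ top r ℕ.* suc (top r)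
N≡ r = cong (_∸ 1) (sym (quotient-size r))

f₁*quotient : ∀ r → f₁ r * quotient r ≋ 1+x^ (4 ^ r ∸ 1)
f₁*quotient r = ≋-trans (*-congʳ (quotient r) (≋-reflexive (f₁≡quadrinomial r)))
  (≋-trans (quotient-correct r) (≋-reflexive (cong 1+x^_ (sym (N≡ r)))))

-- Keeps the exponents m and m + 2 of f away from 0 and 1, so that the terms 1 and x do not cancel.
2≤top : ∀ {r} → 3 ≤ r → 2 ≤ top r
2≤top (s≤s {n = r} 2≤r) = ℕ.+-mono-≤ {1} {top r} {1} (1≤top 2≤r) (s≤s z≤n)
  where
  1≤top : ∀ {r} → 2 ≤ r → 1 ≤ top r
  1≤top (s≤s {n = r} _) = ℕ.≤-trans (s≤s z≤n) (ℕ.m≤n+m (suc (top r)) (top r))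

f₁-isOrder : ∀ {r} → 3 ≤ r → IsOrder (f₁ r) (4 ^ r ∸ 1)
f₁-isOrder {r} 3≤r = record
  { constantTerm = trans (cong (λ f → coeff f 0) (f₁≡quadrinomial r)) (proj₁ (low-coeffs (2≤top 3≤r)))
  ; degree≥1     = 1 , s≤s z≤n , trans (cong (λ f → coeff f 1) (f₁≡quadrinomial r)) (proj₂ (low-coeffs (2≤top 3≤r)))
  ; positive     = subst (1 ≤_) (sym (N≡ r)) (ℕ.≤-trans 1≤m (ℕ.m≤m+n (top r) _))
  -- `_∣_` expects the cofactor on the left.
  ; divides      = quotient r ∣-by at (≋-trans (*-comm (quotient r) (f₁ r)) (f₁*quotient r))
  ; least        = λ { E 1≤E (p ∣-by pf) → subst (_≤ E) (sym (N≡ r))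
      (order-minimal {f₁ r} {quotient r} {p} 1≤m (quotient-pattern r)
        (≋-trans (f₁*quotient r) (≋-reflexive (cong 1+x^_ (N≡ r)))) (pointwise pf) 1≤E) } }
  where
  1≤m : 1 ≤ top r
  1≤m = ℕ.≤-trans (s≤s z≤n) (2≤top 3≤r)
  low-coeffs : ∀ {m} → 2 ≤ m → coeff (quadrinomial m) 0 ≡ true × coeff (quadrinomial m) 1 ≡ true
  low-coeffs (s≤s (s≤s z≤n)) = refl , refl

ℓ₁-quotient+3^ : ∀ r → ℓ₁ (quotient r) ℕ.+ 3 ^ r ≡ 4 ^ r
ℓ₁-quotient+3^ r = trans (cong (ℓ₁ (quotient r) ℕ.+_) (sym (ℓ₁-rows r)))
  (trans (ℓ₁-map-not (concat (rows r))) (trans (length-concat-rows r) (quotient-size r)))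

ℓ₁-quotient : ∀ r → ℓ₁ (quotient r) ≡ c₁ r
ℓ₁-quotient r = trans (sym (ℕ.m+n∸n≡m (ℓ₁ (quotient r)) (3 ^ r)))
  (trans (cong (_∸ 3 ^ r) (ℓ₁-quotient+3^ r)) (sym (c₁≡4^r∸3^r r)))

ℓ₀-quotient : ∀ r → 1 ≤ 4 ^ r ∸ 1 → ℓ₀ (4 ^ r ∸ 1 ∸ 1) (quotient r) ≡ d₁ r
ℓ₀-quotient r 1≤N = ℕ.+-cancelʳ-≡ (ℓ₁ (quotient r)) _ _ (trans
  (ℓ₀+ℓ₁ (quotient r) 1≤N (λ k N≤k → beyond (subst (_≤ k) (N≡ r) N≤k)))
  (trans (cong (_∸ 1) (sym (ℓ₁-quotient+3^ r)))
    (trans (ℕ.+-∸-assoc (ℓ₁ (quotient r)) (ℕ.m^n>0 3 r)) (ℕ.+-comm (ℓ₁ (quotient r)) (d₁ r)))))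
  where open Pattern (quotient-pattern r)

-- Robustness amounts to 3^r < 4^r - 3^r. For r = 2 this fails, as 18 > 16; from r = 3 on, the left
-- side below grows by the factor 3 and the right side by 4.
3^+3^<4^ : ∀ {r} → 3 ≤ r → 3 ^ r ℕ.+ 3 ^ r < 4 ^ r
3^+3^<4^ 3≤r with ℕ.m≤n⇒∃[o]m+o≡n 3≤r
... | o , refl = go o
  where
  go : ∀ o → 3 ^ (3 ℕ.+ o) ℕ.+ 3 ^ (3 ℕ.+ o) < 4 ^ (3 ℕ.+ o)
  -- The case r = 3 reads 54 < 64, that is, 55 ≤ 55 + 9.
  go zero    = ℕ.m≤m+n 55 9
  go (suc o) = ℕ.≤-<-trans
    (ℕ.≤-reflexive (sym (ℕ.*-distribˡ-+ 3 (3 ^ (3 ℕ.+ o)) (3 ^ (3 ℕ.+ o)))))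
    (ℕ.<-≤-trans (ℕ.*-monoʳ-< 3 (go o)) (ℕ.*-monoˡ-≤ (4 ^ (3 ℕ.+ o)) (ℕ.n≤1+n 3)))

c₁>d₁+1 : ∀ {r} → 3 ≤ r → c₁ r > d₁ r ℕ.+ 1
c₁>d₁+1 {r} 3≤r = ℕ.≤-<-trans (ℕ.≤-reflexive (ℕ.m∸n+n≡m (ℕ.m^n>0 3 r)))
  (subst (3 ^ r <_) (sym (c₁≡4^r∸3^r r)) (ℕ.m+n≤o⇒m≤o∸n (suc (3 ^ r)) (3^+3^<4^ 3≤r)))

theorem2p8 : (r : ℕ) → 3 ≤ r →
    (∃[ D ] IsOrder (f₁ r) D × D ∣ℕ (4 ^ r ∸ 1)) ×
    (∃[ h ] IsQuotient (4 ^ r ∸ 1) (f₁ r) h × ℓ₁ h ≡ c₁ r) ×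
    IsBeta (4 ^ r ∸ 1) (f₁ r) (c₁ r , d₁ r) ×
    Robust (f₁ r)
theorem2p8 r 3≤r =
    (N , isOrder , ∣-refl)
  , (quotient r , isQuotient , ℓ₁-quotient r)
  , (positive , (N , isOrder , ∣-refl) ,
     (quotient r , isQuotient , cong₂ _,_ (ℓ₁-quotient r) (ℓ₀-quotient r positive)))
  , (N , quotient r , isOrder , isQuotient ,
     subst (λ (a , b) → a > b ℕ.+ 1)
       (sym (cong₂ _,_ (ℓ₁-quotient r) (ℓ₀-quotient r positive))) (c₁>d₁+1 3≤r))
  where
  N = 4 ^ r ∸ 1
  isOrder = f₁-isOrder 3≤r
  isQuotient = at (f₁*quotient r)
  open IsOrder isOrder using (positive)
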